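{- Let $\overline{Q}$ be an $r$-prover question set that is constructible by conditioning. Then $\overline{Q}$ admits exponential parallel repetition.
   Context: Question sets and games: an $r$-prover question set is a finite nonempty $\overline{Q}\subseteq Q^{(1)}\times\cdots\times Q^{(r)}$ with finite $Q^{(j)}$ such that every element of each $Q^{(j)}$ occurs as a $j$-th coordinate of some tuple of $\overline{Q}$. An $r$-prover game with question set $\overline{Q}$ is $(\overline{Q},\overline{A},V)$, $\overline{A}=A^{(1)}\times\cdots\times A^{(r)}$ finite alphabets, $V:\overline{Q}\times\overline{A}\to\{0,1\}$; its value is the maximum over strategies $\mathcal{S}^{(j)}:Q^{(j)}\to A^{(j)}$ of the probability, over uniform $\overline{q}\in\overline{Q}$, that $V(\overline{q},\mathcal{S}^{(1)}(q^{(1)}),\dots,\mathcal{S}^{(r)}(q^{(r)}))=1$; it is trivial if the value is 1. The $n$-fold repetition $\mathcal{G}^n$ has question set $\overline{Q}^n$ (prover $j$ gets the $n$ $j$-th coordinates), answer alphabets $(A^{(j)})^n$, and accepts iff $V$ accepts in all coordinates. $\omega_{\overline{Q}}(n)$ is the supremum of $\mathrm{val}(\mathcal{G}^n)$ over non-trivial games with question set $\overline{Q}$; $\overline{Q}$ admits exponential parallel repetition if there is $C<1$ with $\omega_{\overline{Q}}(n)\le C^n$ for all $n$. Hypergraph view: $\overline{Q}$ is identified with the $r$-partite $r$-uniform hypergraph with (pairwise disjoint) vertex classes $Q^{(1)},\dots,Q^{(r)}$ and hyperedge set $\overline{Q}$. A homomorphism from $(Q^{(1)},\dots,Q^{(r)},\overline{Q})$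 to $(P^{(1)},\dots,P^{(r)},\overline{P})$ is $f=(f^{(1)},\dots,f^{(r)})$ with $f^{(j)}:Q^{(j)}\to P^{(j)}$ such that $(q^{(1)},\dots,q^{(r)})\in\overline{Q}$ implies $(f^{(1)}(q^{(1)}),\dots,f^{(r)}(q^{(r)}))\in\overline{P}$. For $P^{(j)}\subseteq Q^{(j)}$, the section hypergraph is $(P^{(1)},\dots,P^{(r)},\overline{P})$ with $\overline{P}$ the set of hyperedges of $\overline{Q}$ all of whose vertices lie in $P^{(1)}\cup\dots\cup P^{(r)}$. Constructible by conditioning (defined recursively, up to renaming of vertices): (1) A single hyperedge $(\{q^{(1)}\},\dots,\{q^{(r)}\},\{(q^{(1)},\dots,q^{(r)})\})$ is constructible. (2) Doubling: if $(P^{(1)}\sqcup Q^{(1)},\dots,P^{(r)}\sqcup Q^{(r)},\overline{P})$ is constructible, let $R^{(j)}=\{q': q\in Q^{(j)}\}$ be fresh copies of the vertices of $Q^{(j)}$ (vertices of $P^{(j)}$ are "fixed", of $Q^{(j)}$ "old", of $R^{(j)}$ "new"). For a hyperedge $\overline{q}\in\overline{P}$ not all of whose vertices are fixed, let $\overline{q}'$ be obtained by replacing each of its old vertices by its copy. Then $(P^{(1)}\sqcup Q^{(1)}\sqcup R^{(1)},\dots,P^{(r)}\sqcup Q^{(r)}\sqcup R^{(r)},\overline{P}\cup\{\overline{q}':\overline{q}\in\overline{P}\text{ not all of whose vertices are fixed}\})$ is constructible. (3) Collapse: if $(P^{(1)}\sqcup Q^{(1)},\dots,P^{(r)}\sqcup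 Q^{(r)},\overline{Q})$ is constructible, $(P^{(1)},\dots,P^{(r)},\overline{P})$ is its section hypergraph on the sets $P^{(j)}$, and there is a homomorphism from $\overline{Q}$ to $\overline{P}$ that is the identity on $P^{(1)}\cup\dots\cup P^{(r)}$, then $(P^{(1)},\dots,P^{(r)},\overline{P})$ is constructible. -}

module Defs where

open import Data.Nat using (ℕ; zero; suc; _+_; _*_; _^_; _≤_; _<_)
open import Data.Fin using (Fin; zero; suc; toℕ; _↑ˡ_; _↑ʳ_; splitAt)
open import Data.Bool using (Bool; true; false; T; _∧_)
open import Data.Unit using (⊤; tt)
open import Data.Product using (Σ; _×_; _,_; ∃₂)
open import Data.Sum using (_⊎_; inj₁; inj₂)
open import Data.List using (List; []; _∷_; [_]; concatMap; allFin; filterᵇ; length)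
open import Data.Bool.ListAction using (and)
import Data.List as L
open import Data.Vec using (Vec; []; _∷_; lookup)
import Data.Vec as V
open import Relation.Nullary using (¬_)
open import Relation.Binary.PropositionalEquality using (_≡_)
open import Function.Bundles using (_↔_; _⇔_; Inverse)

-- r-partite hyperedges.  Vertex class j is Fin (k j); a hyperedge
-- (an element of Q^(1) × ⋯ × Q^(r)) is an r-tuple, encoded as a
-- nested product so that _≡_ on hyperedges is the right equality.

Edge : (r : ℕ) → (Fin r → ℕ) → Set
Edge zero    k = ⊤
Edge (suc r) k = Fin (k zero) × Edge r (λ j → k (suc j))

coord : ∀ {r} {k : Fin r → ℕ} → Edge r k → (j : Fin r) → Fin (k j)
coord {suc r} (v , e) zero    = v
coord {suc r} (v , e) (suc j) = coord e j

mkEdge : ∀ {r} {k : Fin r → ℕ} → ((j : Fin r) → Fin (k j)) → Edge r k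
mkEdge {zero}  f = tt
mkEdge {suc r} f = f zero , mkEdge (λ j → f (suc j))

emap : ∀ {r} {k k' : Fin r → ℕ} → ((j : Fin r) → Fin (k j) → Fin (k' j)) →
       Edge r k → Edge r k'
emap f e = mkEdge (λ j → f j (coord e j))

allEdges : ∀ {r} (k : Fin r → ℕ) → List (Edge r k)
allEdges {zero}  k = [ tt ]
allEdges {suc r} k =
  concatMap (λ v → L.map (λ e → v , e) (allEdges (λ j → k (suc j)))) (allFin (k zero))

-- r-partite r-uniform hypergraphs with vertex classes Fin (k j)
-- (the classes are disjoint by construction); the hyperedge set is a
-- predicate on tuples.

Hyp : (r : ℕ) → (Fin r → ℕ) → Set₁
Hyp r k = Edge r k → Set

-- Doubling.  Vertex class j is laid out as P^(j) ⊔ Q^(j) = Fin (p j + q j)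
-- (first p j vertices fixed, remaining q j old); the result has classes
-- P^(j) ⊔ Q^(j) ⊔ R^(j) = Fin ((p j + q j) + q j), the last q j being
-- the new copies of the old vertices.
module _ {r : ℕ} (p q : Fin r → ℕ) where

  oldIncl : (j : Fin r) → Fin (p j + q j) → Fin ((p j + q j) + q j)
  oldIncl j v = v ↑ˡ q j

  copyMap : (j : Fin r) → Fin (p j + q j) → Fin ((p j + q j) + q j)
  copyMap j v with splitAt (p j) v
  ... | inj₁ a = (a ↑ˡ q j) ↑ˡ q j
  ... | inj₂ b = (p j + q j) ↑ʳ b

  IsFixed : (j : Fin r) → Fin (p j + q j) → Set
  IsFixed j v = toℕ v < p j

  AllFixed : Edge r (λ j → p j + q j) → Set
  AllFixed e = (j : Fin r) → IsFixed j (coord e j)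

  doubling : Hyp r (λ j → p j + q j) → Hyp r (λ j → (p j + q j) + q j)
  doubling H e =
      (Σ (Edge r (λ j → p j + q j)) λ e₀ → H e₀ × e ≡ emap oldIncl e₀)
    ⊎ (Σ (Edge r (λ j → p j + q j)) λ e₀ → H e₀ × ¬ AllFixed e₀ × e ≡ emap copyMap e₀)

  fixedIncl : (j : Fin r) → Fin (p j) → Fin (p j + q j)
  fixedIncl j v = v ↑ˡ q j

  section : Hyp r (λ j → p j + q j) → Hyp r p
  section H e = H (emap fixedIncl e)

data Constructible {r : ℕ} : {k : Fin r → ℕ} → Hyp r k → Set₁ where
  single   : Constructible {k = λ _ → 1} (λ _ → ⊤)
  double   : (p q : Fin r → ℕ) {H : Hyp r (λ j → p j + q j)} →
             Constructible H → Constructible (doubling p q H)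
  collapse : (p q : Fin r → ℕ) {H : Hyp r (λ j → p j + q j)} →
             Constructible H →
             (h : (j : Fin r) → Fin (p j + q j) → Fin (p j)) →
             ((j : Fin r) (v : Fin (p j)) → h j (fixedIncl p q j v) ≡ v) →
             ((e : Edge r (λ j → p j + q j)) → H e → section p q H (emap h e)) →
             Constructible (section p q H)
  rename   : {k k' : Fin r → ℕ} {H : Hyp r k} {H' : Hyp r k'} →
             Constructible H →
             (f : (j : Fin r) → Fin (k j) ↔ Fin (k' j)) →
             ((e : Edge r k) → H e ⇔ H' (emap (λ j → Inverse.to (f j)) e)) →
             Constructible H'

record QuestionSet (r : ℕ) : Set where
  field
    size     : Fin r → ℕ
    isEdge   : Edge r size → Bool
    nonempty : Σ (Edge r size) (λ e → T (isEdge e))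
    covers   : (j : Fin r) (v : Fin (size j)) →
               Σ (Edge r size) (λ e → T (isEdge e) × coord e j ≡ v)

open QuestionSet public

asHyp : ∀ {r} (Q : QuestionSet r) → Hyp r (size Q)
asHyp Q e = T (isEdge Q e)

-- the list of hyperedges (each exactly once)
questions : ∀ {r} (Q : QuestionSet r) → List (Edge r (size Q))
questions Q = filterᵇ (isEdge Q) (allEdges (size Q))

Verifier : ∀ {r} → QuestionSet r → (Fin r → ℕ) → Set
Verifier {r} Q a = Edge r (size Q) → Edge r a → Bool

Strategy : ∀ {r} → QuestionSet r → (Fin r → ℕ) → Set
Strategy {r} Q a = (j : Fin r) → Fin (size Q j) → Fin (a j)

-- trivial = value 1 = some strategy wins on every question
Trivial : ∀ {r} (Q : QuestionSet r) (a : Fin r → ℕ) → Verifier Q a → Set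
Trivial Q a V = Σ (Strategy Q a) λ S →
  (e : Edge _ (size Q)) → T (isEdge Q e) → T (V e (emap S e))

seqs : {A : Set} → List A → (n : ℕ) → List (Vec A n)
seqs xs zero    = [ [] ]
seqs xs (suc n) = concatMap (λ x → L.map (λ v → x ∷ v) (seqs xs n)) xs

RepStrategy : ∀ {r} → QuestionSet r → (Fin r → ℕ) → ℕ → Set
RepStrategy {r} Q a n = (j : Fin r) → Vec (Fin (size Q j)) n → Vec (Fin (a j)) n

repAccepts : ∀ {r} (Q : QuestionSet r) (a : Fin r → ℕ) (V : Verifier Q a) (n : ℕ) →
             RepStrategy Q a n → Vec (Edge r (size Q)) n → Bool
repAccepts Q a V n S qs =
  and (L.map (λ i → V (lookup qs i)
               (mkEdge (λ j → lookup (S j (V.map (λ e → coord e j) qs)) i)))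
      (allFin n))

repWins : ∀ {r} (Q : QuestionSet r) (a : Fin r → ℕ) (V : Verifier Q a) (n : ℕ) →
          RepStrategy Q a n → ℕ
repWins Q a V n S = length (filterᵇ (repAccepts Q a V n S) (seqs (questions Q) n))

-- exponential parallel repetition: ∃ C = c/d < 1 such that for all n,
-- every non-trivial game G with question set Q and every strategy for
-- G^n wins with probability ≤ C^n, i.e. ω_Q(n) ≤ C^n.
ExpParallelRepetition : ∀ {r} → QuestionSet r → Set
ExpParallelRepetition {r} Q =
  ∃₂ λ (c d : ℕ) → c < d ×
    ((n : ℕ) (a : Fin r → ℕ) (V : Verifier Q a) → ¬ Trivial Q a V →
     (S : RepStrategy Q a n) →
     repWins Q a V n S * d ^ n ≤ c ^ n * length (questions Q) ^ n)

{-# OPTIONS --safe #-}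
module Submission where

-- Each step of a construction of H carries along a random map H → Q whose support
-- contains all homomorphisms, such that n independent copies of it carry all
-- hyperedges of H into a given S ⊆ Q^n of measure μ with probability at least μ^K.
-- A doubling draws the copied vertices conditionally independently given the
-- fixed ones: Cauchy–Schwarz doubles K, and both halves of a homomorphism agree on
-- the fixed part, so full support persists. A collapse restricts the map; a
-- homomorphism on the section extends by composing with the retraction.
-- For H = Q, the identity then has positive probability δ. If S is the winning
-- set of a non-trivial game and all hyperedges land in S, then no coordinate is the
-- identity map (fixing the other coordinates would yield a perfect strategy), so
-- μ^K ≤ (1 - δ)^n.

open import Defs
open import Data.Nat using (ℕ; zero; suc; pred; _+_; _*_; _^_; _≤_; _<_; _!; z≤n; s≤s; NonZero; >-nonZero; ≢-nonZero⁻¹)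
open import Data.Nat.Properties
open import Data.Nat.Divisibility using (_∣_; quotient; ∣-trans; m∣m*n; m≤n⇒m!∣n!)
open import Data.Nat.Tactic.RingSolver using (solve-∀)
open import Data.Bool using (Bool; true; false; T; _∧_; if_then_else_)
open import Data.Bool.Properties using (T-∧)
open import Data.Fin using (Fin; zero; suc; toℕ; _↑ˡ_; _↑ʳ_; splitAt)
open import Data.Fin.Properties using (all?; splitAt-↑ˡ; splitAt-↑ʳ; toℕ-↑ˡ; toℕ<n; toℕ-↑ʳ; splitAt⁻¹-↑ˡ; splitAt⁻¹-↑ʳ)
  renaming (_≟_ to _≟ᶠ_)
open import Data.List as L using (List; []; _∷_; concatMap; allFin; filterᵇ; length; replicate; _++_)
open import Data.List.Properties using (map-tabulate; tabulate-lookup; length-tabulate)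
open import Data.List.Membership.Propositional using (_∈_; lose)
open import Data.List.Membership.Propositional.Properties using (∈-allFin; ∈-map⁺; ∈-concatMap⁺; ∈-filter⁺)
open import Data.List.Relation.Unary.Any using (here; there; index)
open import Data.List.Relation.Unary.Any.Properties using (lookup-index)
open import Data.List.Relation.Unary.All as All using ()
open import Data.List.Relation.Unary.All.Properties using (all⁺)
open import Data.Vec as V using (Vec; []; _∷_; lookup)
open import Data.Vec.Properties using (map-cong; map-∘; lookup-map)
open import Data.Product using (Σ; ∃; _×_; _,_; proj₁; proj₂)
open import Data.Sum using (inj₁; inj₂; [_,_]′)
open import Data.Unit using (⊤; tt)
open import Function using (_∘_; id)
open import Function.Bundles using (_↔_; _⇔_; Inverse; Equivalence)
open import Relation.Nullary using (¬_; Dec; yes; no; does; contradiction)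
open import Relation.Nullary.Decidable using (dec-true; dec-false; T?)
open import Relation.Binary.PropositionalEquality

-- Sums over lists

∑ : {A : Set} → List A → (A → ℕ) → ℕ
∑ []       f = 0
∑ (x ∷ xs) f = f x + ∑ xs f

private
  variable
    A B : Set
    n : ℕ

∑-cong : (xs : List A) {f g : A → ℕ} → (∀ x → f x ≡ g x) → ∑ xs f ≡ ∑ xs g
∑-cong []       e = refl
∑-cong (x ∷ xs) e = cong₂ _+_ (e x) (∑-cong xs e)

∑-mono : (xs : List A) {f g : A → ℕ} → (∀ x → f x ≤ g x) → ∑ xs f ≤ ∑ xs g
∑-mono []       e = z≤n
∑-mono (x ∷ xs) e = +-mono-≤ (e x) (∑-mono xs e)

∑-mono-< : {xs : List A} {f g : A → ℕ} {i : A} → i ∈ xs →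
           (∀ x → f x ≤ g x) → f i < g i → ∑ xs f < ∑ xs g
∑-mono-< {xs = _ ∷ xs} (here refl) e lt = +-mono-<-≤ lt (∑-mono xs e)
∑-mono-< {xs = x ∷ _}  (there p)   e lt = +-mono-≤-< (e x) (∑-mono-< p e lt)

term≤∑ : {xs : List A} {i : A} → i ∈ xs → (f : A → ℕ) → f i ≤ ∑ xs f
term≤∑ (here refl)         f = m≤m+n _ _
term≤∑ {xs = x ∷ _} (there p) f = ≤-trans (term≤∑ p f) (m≤n+m _ (f x))

∑-+ : (xs : List A) (f g : A → ℕ) → ∑ xs (λ x → f x + g x) ≡ ∑ xs f + ∑ xs g
∑-+ []       f g = refl
∑-+ (x ∷ xs) f g rewrite ∑-+ xs f g = interchange (f x) (g x) (∑ xs f) (∑ xs g)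
  where
  interchange : ∀ a b c d → a + b + (c + d) ≡ a + c + (b + d)
  interchange = solve-∀

∑-*ˡ : (xs : List A) (c : ℕ) (f : A → ℕ) → ∑ xs (λ x → c * f x) ≡ c * ∑ xs f
∑-*ˡ []       c f = sym (*-zeroʳ c)
∑-*ˡ (x ∷ xs) c f rewrite ∑-*ˡ xs c f = sym (*-distribˡ-+ c (f x) (∑ xs f))

∑-*ʳ : (xs : List A) (c : ℕ) (f : A → ℕ) → ∑ xs (λ x → f x * c) ≡ ∑ xs f * c
∑-*ʳ []       c f = refl
∑-*ʳ (x ∷ xs) c f rewrite ∑-*ʳ xs c f = sym (*-distribʳ-+ c (f x) (∑ xs f))

∑-const : (xs : List A) (c : ℕ) → ∑ xs (λ _ → c) ≡ length xs * c
∑-const []       c = refl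
∑-const (x ∷ xs) c = cong (c +_) (∑-const xs c)

∑-zero : (xs : List A) → ∑ xs (λ _ → 0) ≡ 0
∑-zero xs = trans (∑-const xs 0) (*-zeroʳ (length xs))

∑-swap : (xs : List A) (ys : List B) (f : A → B → ℕ) →
         ∑ xs (λ x → ∑ ys (f x)) ≡ ∑ ys (λ y → ∑ xs (λ x → f x y))
∑-swap []       ys f = sym (∑-zero ys)
∑-swap (x ∷ xs) ys f = trans (cong (∑ ys (f x) +_) (∑-swap xs ys f))
                             (sym (∑-+ ys (f x) _))

∑-++ : (xs ys : List A) (f : A → ℕ) → ∑ (xs ++ ys) f ≡ ∑ xs f + ∑ ys f
∑-++ []       ys f = refl
∑-++ (x ∷ xs) ys f = trans (cong (f x +_) (∑-++ xs ys f)) (sym (+-assoc (f x) _ _))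

∑-map : (g : A → B) (xs : List A) (f : B → ℕ) → ∑ (L.map g xs) f ≡ ∑ xs (f ∘ g)
∑-map g []       f = refl
∑-map g (x ∷ xs) f = cong (f (g x) +_) (∑-map g xs f)

∑-concatMap : (g : A → List B) (xs : List A) (f : B → ℕ) →
              ∑ (concatMap g xs) f ≡ ∑ xs (λ x → ∑ (g x) f)
∑-concatMap g []       f = refl
∑-concatMap g (x ∷ xs) f = trans (∑-++ (g x) _ f) (cong (∑ (g x) f +_) (∑-concatMap g xs f))

∑-replicate : (k : ℕ) (x : A) (f : A → ℕ) → ∑ (replicate k x) f ≡ k * f x
∑-replicate zero    x f = refl
∑-replicate (suc k) x f = cong (f x +_) (∑-replicate k x f)

∑-one : (xs : List A) → ∑ xs (λ _ → 1) ≡ length xs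
∑-one xs = trans (∑-const xs 1) (*-identityʳ _)

∑-product : (xs : List A) (ys : List B) (f : A → ℕ) (g : B → ℕ) →
            ∑ xs (λ x → ∑ ys (λ y → f x * g y)) ≡ ∑ xs f * ∑ ys g
∑-product xs ys f g = trans (∑-cong xs λ x → ∑-*ˡ ys (f x) g) (∑-*ʳ xs _ f)

ind : Bool → ℕ
ind b = if b then 1 else 0

ind-∧ : ∀ a b → ind (a ∧ b) ≡ ind a * ind b
ind-∧ false b = refl
ind-∧ true  b = sym (+-identityʳ _)

length-filterᵇ : (s : A → Bool) (xs : List A) → length (filterᵇ s xs) ≡ ∑ xs (ind ∘ s)
length-filterᵇ s []       = refl
length-filterᵇ s (x ∷ xs) with s x
... | true  = cong suc (length-filterᵇ s xs)
... | false = length-filterᵇ s xs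

-- Sums over `n`-tuples and product weights

∑-seqs-suc : (xs : List A) (f : Vec A (suc n) → ℕ) →
             ∑ (seqs xs (suc n)) f ≡ ∑ xs (λ x → ∑ (seqs xs n) (λ v → f (x ∷ v)))
∑-seqs-suc {n = n} xs f =
  trans (∑-concatMap _ xs f) (∑-cong xs λ x → ∑-map (x ∷_) (seqs xs n) f)

∑-seqs-map : (g : A → B) (xs : List A) (n : ℕ) (f : Vec B n → ℕ) →
             ∑ (seqs (L.map g xs) n) f ≡ ∑ (seqs xs n) (f ∘ V.map g)
∑-seqs-map g xs zero    f = refl
∑-seqs-map g xs (suc n) f = begin
  ∑ (seqs (L.map g xs) (suc n)) f
    ≡⟨ ∑-seqs-suc (L.map g xs) f ⟩
  ∑ (L.map g xs) (λ y → ∑ (seqs (L.map g xs) n) (λ v → f (y ∷ v)))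
    ≡⟨ ∑-map g xs _ ⟩
  ∑ xs (λ x → ∑ (seqs (L.map g xs) n) (λ v → f (g x ∷ v)))
    ≡⟨ ∑-cong xs (λ x → ∑-seqs-map g xs n _) ⟩
  ∑ xs (λ x → ∑ (seqs xs n) (λ v → f (g x ∷ V.map g v)))
    ≡⟨ ∑-seqs-suc xs _ ⟨
  ∑ (seqs xs (suc n)) (f ∘ V.map g) ∎
  where open ≡-Reasoning

-- For a 0/1-valued `c` this is the indicator that every entry of the tuple satisfies `c`; in this
-- form it bounds the event that no coordinate draws the identity.
vprod : (A → ℕ) → Vec A n → ℕ
vprod c []      = 1
vprod c (x ∷ v) = c x * vprod c v

∑-seqs-vprod : (xs : List A) (n : ℕ) (c : A → ℕ) → ∑ (seqs xs n) (vprod c) ≡ ∑ xs c ^ n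
∑-seqs-vprod xs zero    c = refl
∑-seqs-vprod xs (suc n) c = begin
  ∑ (seqs xs (suc n)) (vprod c)                           ≡⟨ ∑-seqs-suc xs _ ⟩
  ∑ xs (λ x → ∑ (seqs xs n) (λ v → c x * vprod c v))      ≡⟨ ∑-product xs (seqs xs n) c (vprod c) ⟩
  ∑ xs c * ∑ (seqs xs n) (vprod c)                        ≡⟨ cong (∑ xs c *_) (∑-seqs-vprod xs n c) ⟩
  ∑ xs c * ∑ xs c ^ n                                     ∎
  where open ≡-Reasoning

vprod-one : (v : Vec A n) → vprod (λ _ → 1) v ≡ 1
vprod-one []      = refl
vprod-one (x ∷ v) = trans (+-identityʳ _) (vprod-one v)

length-seqs : (xs : List A) (n : ℕ) → length (seqs xs n) ≡ length xs ^ n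
length-seqs xs n = begin
  length (seqs xs n)                          ≡⟨ ∑-one (seqs xs n) ⟨
  ∑ (seqs xs n) (λ _ → 1)                     ≡⟨ ∑-cong (seqs xs n) (λ v → sym (vprod-one v)) ⟩
  ∑ (seqs xs n) (vprod (λ _ → 1))             ≡⟨ ∑-seqs-vprod xs n _ ⟩
  ∑ xs (λ _ → 1) ^ n                          ≡⟨ cong (_^ n) (∑-one xs) ⟩
  length xs ^ n                               ∎
  where open ≡-Reasoning

-- Cauchy–Schwarz for scaled orthogonal projections

-- The difference of the two sides is the square of the distance between `a` and `b`. To avoid
-- subtraction, the larger number is written as the smaller one plus `k`.
two-mul-le : ∀ a b → 2 * (a * b) ≤ a * a + b * b
two-mul-le a b = [ le a b , (λ q → subst₂ _≤_ (cong (2 *_) (*-comm b a)) (+-comm (b * b) (a * a)) (le b a q)) ]′ (≤-total a b)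
  where
  eq : ∀ a k → a * a + (a + k) * (a + k) ≡ 2 * (a * (a + k)) + k * k
  eq = solve-∀
  le : ∀ a b → a ≤ b → 2 * (a * b) ≤ a * a + b * b
  le a b q with k , refl ← m≤n⇒∃[o]m+o≡n q = ≤-trans (m≤m+n _ (k * k)) (≤-reflexive (sym (eq a k)))

-- Sum `two-mul-le` over all ordered pairs of entries: the cross terms give the squared sum, the two
-- square terms give equal contributions, and the factor 2 cancels.
cauchy-schwarz : (xs : List A) (f : A → ℕ) →
                 ∑ xs f * ∑ xs f ≤ length xs * ∑ xs (λ x → f x * f x)
cauchy-schwarz xs f = *-cancelˡ-≤ 2 (begin
  2 * (∑ xs f * ∑ xs f)
    ≡⟨ cong (2 *_) (∑-product xs xs f f) ⟨
  2 * ∑ xs (λ x → ∑ xs (λ y → f x * f y))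
    ≡⟨ trans (∑-cong xs (λ x → ∑-*ˡ xs 2 _)) (∑-*ˡ xs 2 _) ⟨
  ∑ xs (λ x → ∑ xs (λ y → 2 * (f x * f y)))
    ≤⟨ ∑-mono xs (λ x → ∑-mono xs (λ y → two-mul-le (f x) (f y))) ⟩
  ∑ xs (λ x → ∑ xs (λ y → f x * f x + f y * f y))
    ≡⟨ ∑-cong xs (λ x → trans (∑-+ xs _ _) (cong (_+ S) (∑-const xs (f x * f x)))) ⟩
  ∑ xs (λ x → length xs * (f x * f x) + S)
    ≡⟨ trans (∑-+ xs _ _) (cong₂ _+_ (∑-*ˡ xs (length xs) _) (∑-const xs S)) ⟩
  length xs * S + length xs * S
    ≡⟨ cong (length xs * S +_) (+-identityʳ _) ⟨
  2 * (length xs * S) ∎)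
  where
  open ≤-Reasoning
  S = ∑ xs (λ x → f x * f x)

-- Together the laws say that p / M is a symmetric stochastic idempotent matrix
-- on xs, that is, a conditional expectation.
record Projection (xs : List A) (p : A → A → ℕ) (M : ℕ) : Set where
  field
    symmetric : ∀ x y → p x y ≡ p y x
    rotate    : ∀ x y z → p x y * p x z ≡ p y x * p y z
    row       : ∀ x → ∑ xs (p x) ≡ M

module _ {xs : List A} {p : A → A → ℕ} {M : ℕ} (P : Projection xs p M) where
  open Projection P

  -- Cauchy-Schwarz is applied to `F`, which is `M` times the conditional expectation of `f`.
  -- Averaging preserves the total (`first`), and by idempotence the squared norm of `F` is `M`
  -- times the quadratic form `E` (`second`).
  projection-bound : .{{NonZero M}} → (f : A → ℕ) →
    M * (∑ xs f * ∑ xs f) ≤ length xs * ∑ xs (λ x → ∑ xs (λ y → p x y * (f x * f y)))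
  projection-bound f = *-cancelˡ-≤ M (begin
    M * (M * (∑ xs f * ∑ xs f))
      ≡⟨ sq M (∑ xs f) ⟩
    (M * ∑ xs f) * (M * ∑ xs f)
      ≡⟨ cong₂ _*_ first first ⟨
    ∑ xs F * ∑ xs F
      ≤⟨ cauchy-schwarz xs F ⟩
    length xs * ∑ xs (λ x → F x * F x)
      ≡⟨ cong (length xs *_) second ⟩
    length xs * (M * E)
      ≡⟨ swap (length xs) M E ⟩
    M * (length xs * E) ∎)
    where
    open ≤-Reasoning
    F : A → ℕ
    F x = ∑ xs (λ y → p x y * f y)
    E = ∑ xs (λ x → ∑ xs (λ y → p x y * (f x * f y)))
    sq : ∀ a b → a * (a * (b * b)) ≡ (a * b) * (a * b)
    sq = solve-∀
    swap : ∀ a b c → a * (b * c) ≡ b * (a * c)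
    swap = solve-∀
    first : ∑ xs F ≡ M * ∑ xs f
    first = begin-equality
      ∑ xs (λ x → ∑ xs (λ y → p x y * f y))  ≡⟨ ∑-swap xs xs _ ⟩
      ∑ xs (λ y → ∑ xs (λ x → p x y * f y))  ≡⟨ ∑-cong xs (λ y → ∑-*ʳ xs (f y) _) ⟩
      ∑ xs (λ y → ∑ xs (λ x → p x y) * f y)
        ≡⟨ ∑-cong xs (λ y → cong (_* f y) (trans (∑-cong xs (λ x → symmetric x y)) (row y))) ⟩
      ∑ xs (λ y → M * f y)                   ≡⟨ ∑-*ˡ xs M f ⟩
      M * ∑ xs f                             ∎
    second : ∑ xs (λ x → F x * F x) ≡ M * E
    second = begin-equality
      ∑ xs (λ x → F x * F x)
        ≡⟨ ∑-cong xs (λ x → ∑-product xs xs _ _) ⟨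
      ∑ xs (λ x → ∑ xs (λ y → ∑ xs (λ z → p x y * f y * (p x z * f z))))
        ≡⟨ ∑-swap xs xs _ ⟩
      ∑ xs (λ y → ∑ xs (λ x → ∑ xs (λ z → p x y * f y * (p x z * f z))))
        ≡⟨ ∑-cong xs (λ y → ∑-swap xs xs _) ⟩
      ∑ xs (λ y → ∑ xs (λ z → ∑ xs (λ x → p x y * f y * (p x z * f z))))
        ≡⟨ ∑-cong xs (λ y → ∑-cong xs (λ z → inner y z)) ⟩
      ∑ xs (λ y → ∑ xs (λ z → M * (p y z * (f y * f z))))
        ≡⟨ trans (∑-cong xs (λ y → ∑-*ˡ xs M _)) (∑-*ˡ xs M _) ⟩
      M * E ∎
      where
      inner : ∀ y z → ∑ xs (λ x → p x y * f y * (p x z * f z)) ≡ M * (p y z * (f y * f z))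
      inner y z = begin-equality
        ∑ xs (λ x → p x y * f y * (p x z * f z))
          -- `rotate` moves the dependence on `x` into the single factor `p y x`, so that `x` can be
          -- summed out by `row y`.
          ≡⟨ ∑-cong xs (λ x → trans ([m*n]*[o*p]≡[m*o]*[n*p] (p x y) (f y) (p x z) (f z))
               (trans (cong (_* (f y * f z)) (rotate x y z)) (*-assoc (p y x) _ _))) ⟩
        ∑ xs (λ x → p y x * (p y z * (f y * f z)))
          ≡⟨ ∑-*ʳ xs _ (p y) ⟩
        ∑ xs (p y) * (p y z * (f y * f z))
          ≡⟨ cong (_* (p y z * (f y * f z))) (row y) ⟩
        M * (p y z * (f y * f z)) ∎

-- Tensor powers of projections

vkernel : (A → A → ℕ) → Vec A n → Vec A n → ℕ
vkernel p []      []      = 1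
vkernel p (x ∷ v) (y ∷ w) = p x y * vkernel p v w

-- Each law holds in every coordinate and multiplies. The tensor power is needed because the event
-- to which `projection-bound` is applied is an arbitrary set of `n`-tuples, not a product set.
vprojection : {xs : List A} {p : A → A → ℕ} {M : ℕ} → Projection xs p M →
              (n : ℕ) → Projection (seqs xs n) (vkernel p) (M ^ n)
vprojection {A} {xs} {p} {M} P n = record { symmetric = vsym ; rotate = vrot ; row = vrow }
  where
  open Projection P
  vsym : ∀ {n} (v w : Vec A n) → vkernel p v w ≡ vkernel p w v
  vsym []      []      = refl
  vsym (x ∷ v) (y ∷ w) = cong₂ _*_ (symmetric x y) (vsym v w)
  vrot : ∀ {n} (u v w : Vec A n) →
         vkernel p u v * vkernel p u w ≡ vkernel p v u * vkernel p v w
  vrot []      []      []      = refl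
  vrot (x ∷ u) (y ∷ v) (z ∷ w) = begin
    p x y * vkernel p u v * (p x z * vkernel p u w)   ≡⟨ [m*n]*[o*p]≡[m*o]*[n*p] (p x y) _ _ _ ⟩
    p x y * p x z * (vkernel p u v * vkernel p u w)   ≡⟨ cong₂ _*_ (rotate x y z) (vrot u v w) ⟩
    p y x * p y z * (vkernel p v u * vkernel p v w)   ≡⟨ [m*n]*[o*p]≡[m*o]*[n*p] (p y x) _ _ _ ⟩
    p y x * vkernel p v u * (p y z * vkernel p v w)   ∎
    where open ≡-Reasoning
  vrow : ∀ {n} (v : Vec A n) → ∑ (seqs xs n) (vkernel p v) ≡ M ^ n
  vrow         []      = refl
  vrow {suc n} (x ∷ v) = begin
    ∑ (seqs xs (suc n)) (vkernel p (x ∷ v))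
      ≡⟨ ∑-seqs-suc xs _ ⟩
    ∑ xs (λ y → ∑ (seqs xs n) (λ w → p x y * vkernel p v w))
      ≡⟨ ∑-product xs (seqs xs n) (p x) (vkernel p v) ⟩
    ∑ xs (p x) * ∑ (seqs xs n) (vkernel p v)
      ≡⟨ cong₂ _*_ (row x) (vrow v) ⟩
    M * M ^ n ∎
    where open ≡-Reasoning

-- The hypothesis says that `zs` contains the pair `x`, `y` with multiplicity `p x y`; it tensorises
-- by peeling off one coordinate. The function `φ` absorbs the sum over the remaining coordinates,
-- so the hypothesis applies to the first pair alone.
∑-seqs-pairs : (zs : List B) (xs : List A) (fst snd : B → A) (p : A → A → ℕ) →
  (∀ (φ : A → A → ℕ) → ∑ zs (λ z → φ (fst z) (snd z)) ≡ ∑ xs (λ x → ∑ xs (λ y → p x y * φ x y))) →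
  (n : ℕ) (F : Vec A n → Vec A n → ℕ) →
  ∑ (seqs zs n) (λ v → F (V.map fst v) (V.map snd v)) ≡
  ∑ (seqs xs n) (λ v → ∑ (seqs xs n) (λ w → vkernel p v w * F v w))
∑-seqs-pairs zs xs fst snd p hyp zero    F rewrite +-identityʳ (F [] []) = sym (trans (+-identityʳ _) (+-identityʳ _))
∑-seqs-pairs {A = A} zs xs fst snd p hyp (suc n) F = begin
  ∑ (seqs zs (suc n)) (λ v → F (V.map fst v) (V.map snd v))
    ≡⟨ ∑-seqs-suc zs _ ⟩
  ∑ zs (λ z → ∑ (seqs zs n) (λ v → F (fst z ∷ V.map fst v) (snd z ∷ V.map snd v)))
    ≡⟨ ∑-cong zs (λ z → ∑-seqs-pairs zs xs fst snd p hyp n (λ v w → F (fst z ∷ v) (snd z ∷ w))) ⟩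
  ∑ zs (λ z → φ (fst z) (snd z))
    ≡⟨ hyp φ ⟩
  ∑ xs (λ x → ∑ xs (λ y → p x y * φ x y))
    ≡⟨ ∑-cong xs (λ x → ∑-cong xs (λ y → push x y)) ⟩
  ∑ xs (λ x → ∑ xs (λ y → ∑ vs (λ v → ∑ vs (λ w → p x y * vkernel p v w * F (x ∷ v) (y ∷ w)))))
    ≡⟨ ∑-cong xs (λ x → ∑-swap xs vs _) ⟩
  ∑ xs (λ x → ∑ vs (λ v → ∑ xs (λ y → ∑ vs (λ w → p x y * vkernel p v w * F (x ∷ v) (y ∷ w)))))
    ≡⟨ ∑-cong xs (λ x → ∑-cong vs (λ v → ∑-seqs-suc xs _)) ⟨
  ∑ xs (λ x → ∑ vs (λ v → ∑ (seqs xs (suc n)) (λ w → vkernel p (x ∷ v) w * F (x ∷ v) w)))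
    ≡⟨ ∑-seqs-suc xs _ ⟨
  ∑ (seqs xs (suc n)) (λ v → ∑ (seqs xs (suc n)) (λ w → vkernel p v w * F v w)) ∎
  where
  open ≡-Reasoning
  vs = seqs xs n
  φ : A → A → ℕ
  φ x y = ∑ vs (λ v → ∑ vs (λ w → vkernel p v w * F (x ∷ v) (y ∷ w)))
  push : ∀ x y → p x y * φ x y ≡
         ∑ vs (λ v → ∑ vs (λ w → p x y * vkernel p v w * F (x ∷ v) (y ∷ w)))
  push x y = trans (sym (∑-*ˡ vs (p x y) _)) (∑-cong vs λ v →
             trans (sym (∑-*ˡ vs (p x y) _)) (∑-cong vs λ w → sym (*-assoc (p x y) _ _)))

-- Conditional expectation on the classes of a decidable equivalence

module EquivalenceKernel {m : ℕ} {_~_ : Fin m → Fin m → Set}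
  (~-refl : ∀ {i} → i ~ i) (~-sym : ∀ {i j} → i ~ j → j ~ i)
  (~-trans : ∀ {i j k} → i ~ j → j ~ k → i ~ k)
  (_~?_ : ∀ i j → Dec (i ~ j)) where

  related : Fin m → Fin m → ℕ
  related i j = ind (does (i ~? j))

  related-yes : ∀ {i j} → i ~ j → related i j ≡ 1
  related-yes {i} {j} r = cong ind (dec-true (i ~? j) r)

  related-no : ∀ {i j} → ¬ i ~ j → related i j ≡ 0
  related-no {i} {j} ¬r = cong ind (dec-false (i ~? j) ¬r)

  related-cong : ∀ {i j} k → i ~ j → related i k ≡ related j k
  related-cong {i} {j} k r with j ~? k
  ... | yes s = related-yes (~-trans r s)
  ... | no ¬s = related-no (λ t → ¬s (~-trans (~-sym r) t))

  classSize : Fin m → ℕ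
  classSize i = ∑ (allFin m) (related i)

  classSize-nonZero : ∀ i → NonZero (classSize i)
  classSize-nonZero i = >-nonZero (≤-trans (≤-reflexive (sym (related-yes ~-refl)))
                                           (term≤∑ (∈-allFin i) (related i)))

  classSize≤m : ∀ i → classSize i ≤ m
  classSize≤m i = begin
    classSize i                ≤⟨ ∑-mono (allFin m) (λ j → ind≤1 (does (i ~? j))) ⟩
    ∑ (allFin m) (λ _ → 1)     ≡⟨ ∑-one (allFin m) ⟩
    length (allFin m)          ≡⟨ length-tabulate id ⟩
    m                          ∎
    where
    open ≤-Reasoning
    ind≤1 : ∀ b → ind b ≤ 1
    ind≤1 true  = ≤-refl
    ind≤1 false = z≤n

  ∣-factorial : ∀ k → .{{NonZero k}} → k ≤ m → k ∣ m !
  ∣-factorial (suc k) le = ∣-trans (m∣m*n (k !)) (m≤n⇒m!∣n! le)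

  classSize∣m! : ∀ i → classSize i ∣ m !
  classSize∣m! i = ∣-factorial (classSize i) {{classSize-nonZero i}} (classSize≤m i)

  weight : Fin m → ℕ
  weight i = quotient (classSize∣m! i)

  weight-classSize : ∀ i → weight i * classSize i ≡ m !
  weight-classSize i = sym (_∣_.equality (classSize∣m! i))

  weight-cong : ∀ {i j} → i ~ j → weight i ≡ weight j
  weight-cong {i} {j} r = *-cancelʳ-≡ (weight i) (weight j) (classSize i) {{classSize-nonZero i}} (begin
    weight i * classSize i   ≡⟨ weight-classSize i ⟩
    m !                      ≡⟨ weight-classSize j ⟨
    weight j * classSize j   ≡⟨ cong (weight j *_) (∑-cong (allFin m) (λ k → related-cong k r)) ⟨
    weight j * classSize i   ∎)
    where open ≡-Reasoning

  -- m ! times the conditional expectation on ~-classes; the factorial clears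
  -- the denominators classSize i.
  kernel : Fin m → Fin m → ℕ
  kernel i j = related i j * weight i

  kernel-projection : Projection (allFin m) kernel (m !)
  kernel-projection = record { symmetric = symmetric ; rotate = rotate ; row = row }
    where
    symmetric : ∀ i j → kernel i j ≡ kernel j i
    symmetric i j with i ~? j
    ... | yes r = cong₂ _*_ (sym (related-yes (~-sym r))) (weight-cong r)
    ... | no ¬r = sym (cong (_* weight j) (related-no (¬r ∘ ~-sym)))
    rotate : ∀ i j k → kernel i j * kernel i k ≡ kernel j i * kernel j k
    -- If `i` and `j` are related, their rows of the kernel coincide; otherwise both sides vanish.
    rotate i j k = trans (cong (_* kernel i k) (symmetric i j)) (step (j ~? i))
      where
      step : Dec (j ~ i) → kernel j i * kernel i k ≡ kernel j i * kernel j k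
      step (yes r) = cong (kernel j i *_) (sym (cong₂ _*_ (related-cong k r) (weight-cong r)))
      step (no ¬r) rewrite related-no ¬r = refl
    row : ∀ i → ∑ (allFin m) (kernel i) ≡ m !
    row i = trans (∑-*ʳ (allFin m) (weight i) (related i))
                  (trans (*-comm (classSize i) (weight i)) (weight-classSize i))

  -- The proof of relatedness is kept with the pair: gluing two drawn maps needs their agreement on
  -- the fixed vertices.
  RelatedPair : Set
  RelatedPair = Σ (Fin m × Fin m) λ ij → proj₁ ij ~ proj₂ ij

  left right : RelatedPair → Fin m
  left  = proj₁ ∘ proj₁
  right = proj₂ ∘ proj₁

  -- Repeating a pair `weight i` times makes multiplicities equal to the kernel. A uniform entry of
  -- `pairs` thus has a uniform left index and, given it, a right index uniform in the same class.
  pairsAt : ∀ i j → List RelatedPair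
  pairsAt i j with i ~? j
  ... | yes r = replicate (weight i) ((i , j) , r)
  ... | no _  = []

  pairs : List RelatedPair
  pairs = concatMap (λ i → concatMap (pairsAt i) (allFin m)) (allFin m)

  ∑-pairsAt : ∀ i j (φ : Fin m → Fin m → ℕ) →
              ∑ (pairsAt i j) (λ z → φ (left z) (right z)) ≡ kernel i j * φ i j
  ∑-pairsAt i j φ with i ~? j
  ... | yes r = trans (∑-replicate (weight i) _ _) (cong (_* φ i j) (sym (*-identityˡ (weight i))))
  ... | no _  = refl

  ∑-pairs : ∀ (φ : Fin m → Fin m → ℕ) →
    ∑ pairs (λ z → φ (left z) (right z)) ≡
    ∑ (allFin m) (λ i → ∑ (allFin m) (λ j → kernel i j * φ i j))
  ∑-pairs φ = trans (∑-concatMap _ (allFin m) _) (∑-cong (allFin m) λ i →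
              trans (∑-concatMap _ (allFin m) _) (∑-cong (allFin m) λ j → ∑-pairsAt i j φ))

  length-pairs : length pairs ≡ m * m !
  length-pairs = begin
    length pairs
      ≡⟨ ∑-one pairs ⟨
    ∑ pairs (λ _ → 1)
      ≡⟨ ∑-pairs (λ _ _ → 1) ⟩
    ∑ (allFin m) (λ i → ∑ (allFin m) (λ j → kernel i j * 1))
      ≡⟨ ∑-cong (allFin m) (λ i → trans (∑-cong (allFin m) (λ j → *-identityʳ _)) (row i)) ⟩
    ∑ (allFin m) (λ _ → m !)
      ≡⟨ trans (∑-const (allFin m) (m !)) (cong (_* m !) (length-tabulate {n = m} id)) ⟩
    m * m ! ∎
    where
    open ≡-Reasoning
    open Projection kernel-projection

  -- Weights are positive because `weight i * classSize i` is a factorial, so no related pair is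
  -- missed. Full support of a doubling rests on this.
  ∈-pairs : ∀ {i j} → i ~ j → ∃ λ z → z ∈ pairs × left z ≡ i × right z ≡ j
  ∈-pairs {i} {j} r = proj₁ at , outer , proj₂ (proj₂ at)
    where
    weight-pos : 0 < weight i
    weight-pos = n≢0⇒n>0 λ w≡0 → ≢-nonZero⁻¹ (m !) {{m !≢0}}
      (trans (sym (weight-classSize i)) (cong (_* classSize i) w≡0))
    ∈-replicate : {A : Set} {x : A} {k : ℕ} → 0 < k → x ∈ replicate k x
    ∈-replicate {k = suc k} _ = here refl
    at : ∃ λ z → z ∈ pairsAt i j × left z ≡ i × right z ≡ j
    at with i ~? j
    ... | yes s = ((i , j) , s) , ∈-replicate weight-pos , refl , refl
    ... | no ¬r = contradiction r ¬r
    outer : proj₁ at ∈ pairs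
    outer = ∈-concatMap⁺ _ (lose (∈-allFin i) (∈-concatMap⁺ _ (lose (∈-allFin j) (proj₁ (proj₂ at)))))

-- Hyperedges and vertex maps

coord-mkEdge : ∀ {r} {k : Fin r → ℕ} (f : ∀ j → Fin (k j)) j → coord (mkEdge {k = k} f) j ≡ f j
coord-mkEdge f zero    = refl
coord-mkEdge f (suc j) = coord-mkEdge (λ i → f (suc i)) j

mkEdge-cong : ∀ {r} {k : Fin r → ℕ} {f g : ∀ j → Fin (k j)} → (∀ j → f j ≡ g j) →
              mkEdge {k = k} f ≡ mkEdge g
mkEdge-cong {zero}  e = refl
mkEdge-cong {suc r} e = cong₂ _,_ (e zero) (mkEdge-cong (λ j → e (suc j)))

mkEdge-coord : ∀ {r} {k : Fin r → ℕ} (e : Edge r k) → mkEdge (coord e) ≡ e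
mkEdge-coord {zero}  tt      = refl
mkEdge-coord {suc r} (v , e) = cong (v ,_) (mkEdge-coord e)

VertexMap : ∀ {r} → (Fin r → ℕ) → (Fin r → ℕ) → Set
VertexMap k l = ∀ j → Fin (k j) → Fin (l j)

private
  variable
    r : ℕ
    k l : Fin r → ℕ

emap-cong : {f g : VertexMap k l} → (∀ j v → f j v ≡ g j v) → ∀ e → emap f e ≡ emap g e
emap-cong h e = mkEdge-cong (λ j → h j (coord e j))

emap-∘ : {k k₁ k₂ : Fin r → ℕ} (g : VertexMap k₁ k₂) (f : VertexMap k k₁) (e : Edge r k) →
         emap g (emap f e) ≡ emap (λ j → g j ∘ f j) e
emap-∘ g f e = mkEdge-cong (λ j → cong (g j) (coord-mkEdge _ j))

emap-id : {f : VertexMap k k} → (∀ j v → f j v ≡ v) → ∀ e → emap f e ≡ e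
emap-id h e = trans (mkEdge-cong (λ j → h j (coord e j))) (mkEdge-coord e)

IsHom : (H : Hyp r k) (Q : QuestionSet r) → VertexMap k (size Q) → Set
IsHom H Q g = ∀ e → H e → T (isEdge Q (emap g e))

∈-allEdges : (e : Edge r k) → e ∈ allEdges k
∈-allEdges {zero}      tt      = here refl
∈-allEdges {suc r} {k} (v , e) =
  ∈-concatMap⁺ _ (lose (∈-allFin v) (∈-map⁺ (v ,_) (∈-allEdges e)))

∈-questions : (Q : QuestionSet r) {e : Edge r (size Q)} → T (isEdge Q e) → e ∈ questions Q
∈-questions Q {e} te = ∈-filter⁺ (T? ∘ isEdge Q) (∈-allEdges e) te

-- Gluing two vertex maps along the fixed part

module _ (p q : Fin r → ℕ) where

  copyMap-fixed : ∀ j x → IsFixed p q j x → copyMap p q j x ≡ oldIncl p q j x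
  copyMap-fixed j x lt with splitAt (p j) x in eq
  ... | inj₁ a = cong (_↑ˡ q j) (splitAt⁻¹-↑ˡ eq)
  ... | inj₂ b = contradiction lt (≤⇒≯ (≤-trans (m≤m+n (p j) (toℕ b))
                   (≤-reflexive (trans (sym (toℕ-↑ʳ (p j) b)) (cong toℕ (splitAt⁻¹-↑ʳ eq))))))

  copyMap-fixedIncl : ∀ j x → copyMap p q j (fixedIncl p q j x) ≡ oldIncl p q j (fixedIncl p q j x)
  copyMap-fixedIncl j x = copyMap-fixed j _ (subst (_< p j) (sym (toℕ-↑ˡ x (q j))) (toℕ<n x))

  copyMap-old : ∀ j b → copyMap p q j (p j ↑ʳ b) ≡ (p j + q j) ↑ʳ b
  copyMap-old j b rewrite splitAt-↑ʳ (p j) (q j) b = refl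

  AllFixed? : ∀ e → Dec (AllFixed p q e)
  AllFixed? e = all? (λ j → toℕ (coord e j) <? p j)

  Agree : (a b : VertexMap (λ j → p j + q j) l) → Set
  Agree a b = ∀ j x → a j (fixedIncl p q j x) ≡ b j (fixedIncl p q j x)

  Agree? : (a b : VertexMap (λ j → p j + q j) l) → Dec (Agree a b)
  Agree? a b = all? (λ j → all? (λ x → a j (fixedIncl p q j x) ≟ᶠ b j (fixedIncl p q j x)))

  -- Fixed and old vertices follow `a`, new ones follow `b` at the vertex they copy. The choice of
  -- `a` on fixed vertices is immaterial once `a` and `b` agree there.
  glue : (a b : VertexMap (λ j → p j + q j) l) → VertexMap (λ j → (p j + q j) + q j) l
  glue a b j v = [ a j , (λ t → b j (p j ↑ʳ t)) ]′ (splitAt (p j + q j) v)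

  glue-oldIncl : (a b : VertexMap (λ j → p j + q j) l) →
                 ∀ j x → glue a b j (oldIncl p q j x) ≡ a j x
  glue-oldIncl a b j x rewrite splitAt-↑ˡ (p j + q j) x (q j) = refl

  -- Agreement enters here: `copyMap` leaves a fixed vertex in place, where the glued map takes the
  -- value of `a` instead of `b`.
  glue-copyMap : (a b : VertexMap (λ j → p j + q j) l) → Agree a b →
                 ∀ j x → glue a b j (copyMap p q j x) ≡ b j x
  glue-copyMap a b ab j x with splitAt (p j) x in eq
  ... | inj₁ t = trans (glue-oldIncl a b j (t ↑ˡ q j)) (trans (ab j t) (cong (b j) (splitAt⁻¹-↑ˡ eq)))
  ... | inj₂ t rewrite splitAt-↑ʳ (p j + q j) (q j) t = cong (b j) (splitAt⁻¹-↑ʳ eq)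

  -- The images of `oldIncl` and `copyMap` together cover the doubled vertex set, so a map on it is
  -- determined by its two pullbacks.
  glue-unique : (a b : VertexMap (λ j → p j + q j) l) (g : VertexMap (λ j → (p j + q j) + q j) l) →
                (∀ j x → a j x ≡ g j (oldIncl p q j x)) →
                (∀ j x → b j x ≡ g j (copyMap p q j x)) →
                ∀ j v → glue a b j v ≡ g j v
  glue-unique a b g ea eb j v with splitAt (p j + q j) v in eq
  ... | inj₁ x = trans (ea j x) (cong (g j) (splitAt⁻¹-↑ˡ eq))
  ... | inj₂ t = trans (eb j (p j ↑ʳ t)) (cong (g j) (trans (copyMap-old j t) (splitAt⁻¹-↑ʳ eq)))

^-distribʳ-* : ∀ n a b → (a * b) ^ n ≡ a ^ n * b ^ n
^-distribʳ-* zero    a b = refl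
^-distribʳ-* (suc n) a b = trans (cong (a * b *_) (^-distribʳ-* n a b)) ([m*n]*[o*p]≡[m*o]*[n*p] a b (a ^ n) (b ^ n))

-- Samplings: random maps with full support and dense powers

hits : (Q : QuestionSet r) (n : ℕ) → (Vec (Edge r (size Q)) n → Bool) → ℕ
hits Q n S = length (filterᵇ S (seqs (questions Q) n))

-- A uniform distribution on a multiset of maps H → Q, indexed by Fin m, whose
-- support contains every homomorphism and whose n-th power carries H into
-- a set S of n-tuples of questions with probability at least μ(S)^K.
record Sampling (Q : QuestionSet r) (H : Hyp r k) : Set where
  field
    m       : ℕ
    draw    : Fin m → VertexMap k (size Q)
    K       : ℕ
    K>0     : 0 < K
    support : (g : VertexMap k (size Q)) → IsHom H Q g → ∃ λ i → ∀ j v → draw i j v ≡ g j v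
    dense   : (n : ℕ) (S : Vec (Edge r (size Q)) n → Bool) →
              Σ (Vec (Fin m) n → Bool) λ f →
                (∀ v → T (f v) → ∀ e → H e → T (S (V.map (λ i → emap (draw i) e) v))) ×
                (hits Q n S ^ K * m ^ n ≤
                 ∑ (seqs (allFin m) n) (ind ∘ f) * length (questions Q) ^ (n * K))

  m-nonZero : NonZero m
  m-nonZero = >-nonZero (≤-<-trans z≤n (toℕ<n (proj₁ (support _ constant))))
    -- Sending all of class `j` to the `j`-th coordinate of one hyperedge is always a homomorphism,
    -- so full support provides an index.
    where
    constant : IsHom H Q (λ j _ → coord (proj₁ (nonempty Q)) j)
    constant e _ = subst (T ∘ isEdge Q) (sym (mkEdge-coord _)) (proj₂ (nonempty Q))

map-lookup-allFin : (xs : List A) → L.map (L.lookup xs) (allFin (length xs)) ≡ xs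
map-lookup-allFin xs = trans (map-tabulate id (L.lookup xs)) (tabulate-lookup xs)

-- Samplings along the steps of a construction

module _ (Q : QuestionSet r) where

  -- A map from a single hyperedge into `Q` that is a homomorphism is just a question. A uniform
  -- question is drawn, and density holds with equality for `K = 1`.
  single-sampling : Sampling {k = λ _ → 1} Q (λ _ → ⊤)
  single-sampling = record
    { m = length qs ; draw = draw ; K = 1 ; K>0 = s≤s z≤n ; support = support
    ; dense = λ n S → (S ∘ V.map (L.lookup qs)) , carried n S , ≤-reflexive (count n S) }
    where
    qs = questions Q
    draw : Fin (length qs) → VertexMap (λ _ → 1) (size Q)
    draw i j _ = coord (L.lookup qs i) j
    support : ∀ g → IsHom (λ _ → ⊤) Q g → ∃ λ i → ∀ j v → draw i j v ≡ g j v
    support g hom = index mem , λ { j zero → begin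
      coord (L.lookup qs (index mem)) j  ≡⟨ cong (λ e → coord e j) (lookup-index mem) ⟨
      coord (emap g e₀) j                ≡⟨ coord-mkEdge _ j ⟩
      g j (coord e₀ j)                   ≡⟨ cong (g j) (coord-mkEdge _ j) ⟩
      g j zero                           ∎ }
      where
      open ≡-Reasoning
      e₀ : Edge r (λ _ → 1)
      e₀ = mkEdge (λ _ → zero)
      mem : emap g e₀ ∈ qs
      mem = ∈-questions Q (hom e₀ tt)
    carried : ∀ n S (v : Vec (Fin (length qs)) n) → T (S (V.map (L.lookup qs) v)) →
              ∀ e → ⊤ → T (S (V.map (λ i → emap (draw i) e) v))
    carried n S v t e _ = subst (T ∘ S) (map-cong (λ i → sym (mkEdge-coord (L.lookup qs i))) v) t
    count : ∀ n S → hits Q n S ^ 1 * length qs ^ n ≡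
            ∑ (seqs (allFin (length qs)) n) (ind ∘ S ∘ V.map (L.lookup qs)) * length qs ^ (n * 1)
    count n S = cong₂ _*_ (begin
      hits Q n S ^ 1                                ≡⟨ ^-identityʳ _ ⟩
      hits Q n S                                    ≡⟨ length-filterᵇ S (seqs qs n) ⟩
      ∑ (seqs qs n) (ind ∘ S)                       ≡⟨ cong (λ xs → ∑ (seqs xs n) (ind ∘ S)) (map-lookup-allFin qs) ⟨
      ∑ (seqs (L.map (L.lookup qs) (allFin _)) n) (ind ∘ S)
                                                    ≡⟨ ∑-seqs-map (L.lookup qs) (allFin _) n (ind ∘ S) ⟩
      ∑ (seqs (allFin _) n) (ind ∘ S ∘ V.map (L.lookup qs)) ∎)
      (cong (length qs ^_) (sym (*-identityʳ n)))
      where open ≡-Reasoning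

  rename-sampling : {k k' : Fin r → ℕ} {H : Hyp r k} {H' : Hyp r k'} → Sampling Q H →
    (f : (j : Fin r) → Fin (k j) ↔ Fin (k' j)) →
    ((e : Edge r k) → H e ⇔ H' (emap (λ j → Inverse.to (f j)) e)) → Sampling Q H'
  rename-sampling {k} {k'} {H} {H'} s f iff = record
    { m = m ; draw = λ i j → draw i j ∘ from j ; K = K ; K>0 = K>0
    ; support = λ g hom →
        let i , eq = support (λ j → g j ∘ to j)
                       (λ e h → subst (T ∘ isEdge Q) (emap-∘ g to e) (hom _ (Equivalence.to (iff e) h)))
        in i , λ j v → trans (eq j (from j v)) (cong (g j) (to-from j v))
    ; dense = λ n S → let f , carried , count = dense n S in
        f , (λ v t e h → subst (T ∘ S) (map-cong (λ i → emap-∘ (draw i) from e) v)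
               (carried v t (emap from e) (Equivalence.from (iff _)
                 (subst H' (sym (trans (emap-∘ to from e) (emap-id to-from e))) h)))) ,
        count }
    where
    open Sampling s
    to : VertexMap k k'
    to j = Inverse.to (f j)
    from : VertexMap k' k
    from j = Inverse.from (f j)
    to-from : ∀ j v → to j (from j v) ≡ v
    to-from j v = Inverse.strictlyInverseˡ (f j) v

  -- Density is inherited with the same event, since hyperedges of the section are hyperedges of
  -- `H`. The retraction `h` serves the support: it extends a homomorphism `g` on the section to
  -- `H`.
  collapse-sampling : (p q : Fin r → ℕ) {H : Hyp r (λ j → p j + q j)} → Sampling Q H →
    (h : (j : Fin r) → Fin (p j + q j) → Fin (p j)) →
    ((j : Fin r) (v : Fin (p j)) → h j (fixedIncl p q j v) ≡ v) →
    ((e : Edge r (λ j → p j + q j)) → H e → section p q H (emap h e)) →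
    Sampling Q (section p q H)
  collapse-sampling p q {H} s h h-id h-hom = record
    { m = m ; draw = λ i j → draw i j ∘ fixedIncl p q j ; K = K ; K>0 = K>0
    ; support = λ g hom →
        let i , eq = support (λ j → g j ∘ h j)
                       (λ e he → subst (T ∘ isEdge Q) (emap-∘ g h e) (hom _ (h-hom e he)))
        in i , λ j v → trans (eq j _) (cong (g j) (h-id j v))
    ; dense = λ n S → let f , carried , count = dense n S in
        f , (λ v t e he → subst (T ∘ S) (map-cong (λ i → emap-∘ (draw i) (fixedIncl p q) e) v)
               (carried v t _ he)) ,
        count }
    where open Sampling s

  double-sampling : (p q : Fin r → ℕ) {H : Hyp r (λ j → p j + q j)} → Sampling Q H →
                    Sampling Q (doubling p q H)
  double-sampling p q {H} s = record
    { m = m₂ ; draw = draw₂ ; K = K + K ; K>0 = ≤-trans K>0 (m≤m+n K K)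
    ; support = support₂ ; dense = dense₂ }
    where
    open Sampling s
    instance
      _ = m-nonZero
      _ = m !≢0
    -- Two draws are related when they agree on all fixed vertices, so the kernel conditions on the
    -- fixed part.
    open EquivalenceKernel {m} {λ a b → Agree p q (draw a) (draw b)}
      (λ _ _ → refl) (λ e j x → sym (e j x)) (λ e e′ j x → trans (e j x) (e′ j x))
      (λ a b → Agree? p q (draw a) (draw b))
    m₂ = length pairs
    fst₂ snd₂ : Fin m₂ → Fin m
    fst₂ = left ∘ L.lookup pairs
    snd₂ = right ∘ L.lookup pairs
    draw₂ : Fin m₂ → VertexMap (λ j → (p j + q j) + q j) (size Q)
    draw₂ i = glue p q (draw (fst₂ i)) (draw (snd₂ i))

    support₂ : ∀ g → IsHom (doubling p q H) Q g → ∃ λ i → ∀ j v → draw₂ i j v ≡ g j v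
    support₂ g hom =
      let a , ea = support (λ j → g j ∘ oldIncl p q j) λ e he →
                     subst (T ∘ isEdge Q) (emap-∘ g (oldIncl p q) e) (hom _ (inj₁ (e , he , refl)))
          b , eb = support (λ j → g j ∘ copyMap p q j) λ e he →
                     subst (T ∘ isEdge Q) (emap-∘ g (copyMap p q) e) (hom _ (copy-edge e he))
          z , z∈ , l , r = ∈-pairs {a} {b} λ j x →
            trans (ea j _) (trans (cong (g j) (sym (copyMap-fixedIncl p q j x))) (sym (eb j _)))
          look = sym (lookup-index z∈)
      in index z∈ , glue-unique p q _ _ g
           (λ j x → trans (cong (λ c → draw c j x) (trans (cong left look) l)) (ea j x))
           (λ j x → trans (cong (λ c → draw c j x) (trans (cong right look) r)) (eb j x))
      where
      copy-edge : ∀ e → H e → doubling p q H (emap (copyMap p q) e)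
      -- A doubling adds no copy of an all-fixed hyperedge, but such a hyperedge is its own copy and
      -- is already present as an old one.
      copy-edge e he with AllFixed? p q e
      ... | yes fixed = inj₁ (e , he , mkEdge-cong (λ j → copyMap-fixed p q j _ (fixed j)))
      ... | no ¬fixed = inj₂ (e , he , ¬fixed , refl)

    dense₂ : ∀ n S → Σ (Vec (Fin m₂) n → Bool) λ f →
      (∀ v → T (f v) → ∀ e → doubling p q H e → T (S (V.map (λ i → emap (draw₂ i) e) v))) ×
      (hits Q n S ^ (K + K) * m₂ ^ n ≤
       ∑ (seqs (allFin m₂) n) (ind ∘ f) * length (questions Q) ^ (n * (K + K)))
    -- The inductive bound is squared, which doubles `K`, and `projection-bound` compares the
    -- squared count with the count of related pairs lying in `f` on both sides. The extra factor
    -- `X` matches its normalisation and cancels.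
    dense₂ n S with f , carried , count ← dense n S = f₂ , carried₂ , *-cancelˡ-≤ X {{m^n≢0 m n}} (begin
      X * (w ^ (K + K) * m₂ ^ n)
        ≡⟨ cong (X *_) (cong₂ _*_ (^-distribˡ-+-* w K K) m₂^n) ⟩
      X * (w ^ K * w ^ K * (X * M))
        ≡⟨ regroup X (w ^ K) M ⟩
      M * (w ^ K * X * (w ^ K * X))
        ≤⟨ *-monoʳ-≤ M (*-mono-≤ count count) ⟩
      M * (c * R * (c * R))
        ≡⟨ regroup₂ M c R ⟩
      M * (c * c) * (R * R)
        ≤⟨ *-monoˡ-≤ (R * R) (projection-bound (vprojection kernel-projection n) {{m^n≢0 (m !) n}} (ind ∘ f)) ⟩
      length (seqs (allFin m) n) * E * (R * R)
        ≡⟨ cong₂ (λ a b → a * b * (R * R)) X-length E-count ⟩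
      X * c₂ * (R * R)
        ≡⟨ *-assoc X c₂ (R * R) ⟩
      X * (c₂ * (R * R))
        ≡⟨ cong (λ a → X * (c₂ * a)) R-square ⟨
      X * (c₂ * length (questions Q) ^ (n * (K + K))) ∎)
      where
      open ≤-Reasoning
      f₂ : Vec (Fin m₂) n → Bool
      f₂ v = f (V.map fst₂ v) ∧ f (V.map snd₂ v)
      carried₂ : ∀ v → T (f₂ v) → ∀ e → doubling p q H e → T (S (V.map (λ i → emap (draw₂ i) e) v))
      carried₂ v t _ (inj₁ (e , he , refl)) =
        subst (T ∘ S) (trans (sym (map-∘ _ fst₂ v)) (map-cong step v))
          (carried _ (proj₁ (Equivalence.to T-∧ t)) e he)
        where
        step : ∀ i → emap (draw (fst₂ i)) e ≡ emap (draw₂ i) (emap (oldIncl p q) e)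
        step i = sym (trans (emap-∘ (draw₂ i) (oldIncl p q) e) (emap-cong (glue-oldIncl p q (draw (fst₂ i)) (draw (snd₂ i))) e))
      carried₂ v t _ (inj₂ (e , he , _ , refl)) =
        subst (T ∘ S) (trans (sym (map-∘ _ snd₂ v)) (map-cong step v))
          (carried _ (proj₂ (Equivalence.to (T-∧ {f (V.map fst₂ v)}) t)) e he)
        where
        step : ∀ i → emap (draw (snd₂ i)) e ≡ emap (draw₂ i) (emap (copyMap p q) e)
        step i = sym (trans (emap-∘ (draw₂ i) (copyMap p q) e)
                   (emap-cong (glue-copyMap p q (draw (fst₂ i)) (draw (snd₂ i)) (proj₂ (L.lookup pairs i))) e))
      X = m ^ n
      M = (m !) ^ n
      w = hits Q n S
      R = length (questions Q) ^ (n * K)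
      c = ∑ (seqs (allFin m) n) (ind ∘ f)
      c₂ = ∑ (seqs (allFin m₂) n) (ind ∘ f₂)
      E = ∑ (seqs (allFin m) n) (λ u → ∑ (seqs (allFin m) n) (λ v →
            vkernel kernel u v * (ind (f u) * ind (f v))))
      regroup : ∀ x a b → x * (a * a * (x * b)) ≡ b * (a * x * (a * x))
      regroup = solve-∀
      regroup₂ : ∀ x a b → x * (a * b * (a * b)) ≡ x * (a * a) * (b * b)
      regroup₂ = solve-∀
      m₂^n : m₂ ^ n ≡ X * M
      m₂^n = trans (cong (_^ n) length-pairs) (^-distribʳ-* n m (m !))
      X-length : length (seqs (allFin m) n) ≡ X
      X-length = trans (length-seqs (allFin m) n) (cong (_^ n) (length-tabulate {n = m} id))
      E-count : E ≡ c₂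
      -- Kernel entries are multiplicities in `pairs`, so the quadratic form counts the tuples of
      -- pairs accepted by `f₂`.
      E-count = trans (sym (∑-seqs-pairs (allFin m₂) (allFin m) fst₂ snd₂ kernel pair-sum n _))
                      (∑-cong (seqs (allFin m₂) n) (λ v → sym (ind-∧ (f (V.map fst₂ v)) _)))
        where
        pair-sum : ∀ (φ : Fin m → Fin m → ℕ) → ∑ (allFin m₂) (λ i → φ (fst₂ i) (snd₂ i)) ≡
                   ∑ (allFin m) (λ x → ∑ (allFin m) (λ y → kernel x y * φ x y))
        pair-sum φ = trans (sym (∑-map (L.lookup pairs) (allFin m₂) (λ z → φ (left z) (right z))))
          (trans (cong (λ zs → ∑ zs (λ z → φ (left z) (right z))) (map-lookup-allFin pairs)) (∑-pairs φ))
      R-square : length (questions Q) ^ (n * (K + K)) ≡ R * R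
      R-square = trans (cong (length (questions Q) ^_) (*-distribˡ-+ n K K))
                       (^-distribˡ-+-* (length (questions Q)) (n * K) (n * K))

  sampling : {k : Fin r → ℕ} {H : Hyp r k} → Constructible H → Sampling Q H
  sampling single                   = single-sampling
  sampling (double p q c)           = double-sampling p q (sampling c)
  sampling (collapse p q c h id hm) = collapse-sampling p q (sampling c) h id hm
  sampling (rename c f iff)         = rename-sampling (sampling c) f iff

-- Elementary inequalities for the final estimate

vprod-ones : (c : A → ℕ) (v : Vec A n) → (∀ t → c (lookup v t) ≡ 1) → vprod c v ≡ 1
vprod-ones c []      h = refl
vprod-ones c (x ∷ v) h = cong₂ _*_ (h zero) (vprod-ones c v (h ∘ suc))

^-cancelˡ-≤ : ∀ K {a b} → 0 < K → a ^ K ≤ b ^ K → a ≤ b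
^-cancelˡ-≤ K@(suc _) {a} {b} _ le = ≮⇒≥ λ b<a → <⇒≱ (^-monoˡ-< K b<a) le

-- Bernoulli's inequality for the power `suc K` of 1 - 1/(c+1), with denominators cleared and no
-- subtraction.
bernoulli : ∀ c K → suc c ^ suc K ≤ c ^ suc K + suc K * suc c ^ K
bernoulli c zero    = ≤-reflexive (eq c)
  where
  eq : ∀ c → suc c * 1 ≡ c * 1 + 1 * 1
  eq = solve-∀
bernoulli c (suc K) = begin
  suc c * suc c ^ suc K
    ≡⟨ +-comm (suc c ^ suc K) _ ⟩
  c * suc c ^ suc K + suc c ^ suc K
    ≤⟨ +-monoˡ-≤ _ (*-monoʳ-≤ c (bernoulli c K)) ⟩
  c * (c ^ suc K + suc K * suc c ^ K) + suc c ^ suc K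
    ≡⟨ cong (_+ suc c ^ suc K) (*-distribˡ-+ c _ _) ⟩
  c ^ suc (suc K) + c * (suc K * suc c ^ K) + suc c ^ suc K
    ≤⟨ +-monoˡ-≤ _ (+-monoʳ-≤ (c ^ suc (suc K)) (*-monoˡ-≤ _ (n≤1+n c))) ⟩
  c ^ suc (suc K) + suc c * (suc K * suc c ^ K) + suc c ^ suc K
    ≡⟨ regroup (c ^ suc (suc K)) (suc c) (suc K) (suc c ^ K) ⟩
  c ^ suc (suc K) + suc (suc K) * suc c ^ suc K ∎
  where
  open ≤-Reasoning
  regroup : ∀ a d k x → a + d * (k * x) + d * x ≡ a + (1 + k) * (d * x)
  regroup = solve-∀

-- (1 - 1/m) ≤ (1 - 1/(mK))^K with denominators cleared, where c + 1 = mK.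
root-bound : ∀ {l m c} K → l < m → suc c ≡ m * suc K → l * suc c ^ suc K ≤ m * c ^ suc K
root-bound {l} {m} {c} K l<m eq = +-cancelˡ-≤ D _ _ (begin
  -- The added `D` turns `l<m` into a factor: `suc l` copies of `D` are at most `m` copies.
  D + l * D                            ≤⟨ *-monoˡ-≤ D l<m ⟩
  m * D                                ≤⟨ *-monoʳ-≤ m (bernoulli c K) ⟩
  m * (c ^ suc K + suc K * suc c ^ K)  ≡⟨ regroup m (c ^ suc K) (suc K) (suc c ^ K) ⟩
  m * suc K * suc c ^ K + m * c ^ suc K ≡⟨ cong (λ d → d * suc c ^ K + m * c ^ suc K) eq ⟨
  D + m * c ^ suc K                    ∎)
  where
  open ≤-Reasoning
  D = suc c ^ suc K
  regroup : ∀ m a k b → m * (a + k * b) ≡ m * k * b + m * a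
  regroup = solve-∀

-- From a sampling of the question set to exponential decay

module _ (Q : QuestionSet r) (s : Sampling Q (asHyp Q)) where
  open Sampling s

  private
    identity : ∃ λ i → ∀ j v → draw i j v ≡ v
    identity = support (λ _ v → v) (λ e te → subst (T ∘ isEdge Q) (sym (emap-id (λ _ _ → refl) e)) te)

    i₀ : Fin m
    i₀ = proj₁ identity

    -- Only the index `i₀` is excluded. Other indices may draw the identity too, but one excluded
    -- index already makes `others` smaller than `m`.
    nonIdentity : Fin m → ℕ
    nonIdentity i = if does (i ≟ᶠ i₀) then 0 else 1

    others : ℕ
    others = ∑ (allFin m) nonIdentity

    others<m : others < m
    others<m = subst (others <_) (trans (∑-one (allFin m)) (length-tabulate {n = m} id))
            (∑-mono-< (∈-allFin i₀) le lt)
      where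
      le : ∀ i → nonIdentity i ≤ 1
      le i with i ≟ᶠ i₀
      ... | yes _ = z≤n
      ... | no _  = ≤-refl
      lt : nonIdentity i₀ < 1
      lt with i₀ ≟ᶠ i₀
      ... | yes _ = ≤-refl
      ... | no ¬e = contradiction refl ¬e

  -- Fixing the questions of the other coordinates to their images under v turns
  -- a strategy for the repeated game that wins on all of Q into one for the base game.
  trivial-of-identity : ∀ {n} (a : Fin r → ℕ) (V : Verifier Q a) (S : RepStrategy Q a n)
    (v : Vec (Fin m) n) (t : Fin n) → lookup v t ≡ i₀ →
    (∀ e → T (isEdge Q e) → T (repAccepts Q a V n S (V.map (λ i → emap (draw i) e) v))) →
    Trivial Q a V
  trivial-of-identity {n} a V S v t v-t wins = strategy , λ e te →
    subst T (cong₂ V (question e) (answer e)) (All.lookup (all⁺ _ (allFin n) (wins e te)) (∈-allFin t))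
    where
    open ≡-Reasoning
    strategy : Strategy Q a
    strategy j x = lookup (S j (V.map (λ i → draw i j x) v)) t
    question : ∀ e → lookup (V.map (λ i → emap (draw i) e) v) t ≡ e
    question e = begin
      lookup (V.map (λ i → emap (draw i) e) v) t  ≡⟨ lookup-map t _ v ⟩
      emap (draw (lookup v t)) e                  ≡⟨ cong (λ i → emap (draw i) e) v-t ⟩
      emap (draw i₀) e                            ≡⟨ emap-id (proj₂ identity) e ⟩
      e                                           ∎
    -- The questions to prover `j` depend on `e` only through `coord e j`, which makes `strategy` a
    -- legitimate strategy for separate provers.
    answer : ∀ e → mkEdge (λ j → lookup (S j (V.map (λ e → coord e j) (V.map (λ i → emap (draw i) e) v))) t)
                   ≡ emap strategy e
    answer e = mkEdge-cong λ j → cong (λ xs → lookup (S j xs) t)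
      (trans (sym (map-∘ _ _ v)) (map-cong (λ i → coord-mkEdge _ j) v))

  -- By `trivial-of-identity`, a tuple accepted by `f` has no coordinate equal to `i₀`. Hence `f`
  -- lies below a product indicator, whose total is `others ^ n`.
  hits-bound : ∀ n a (V : Verifier Q a) → ¬ Trivial Q a V → (S : RepStrategy Q a n) →
    repWins Q a V n S ^ K * m ^ n ≤ others ^ n * length (questions Q) ^ (n * K)
  hits-bound n a V nontrivial S with f , carried , count ← dense n (repAccepts Q a V n S) =
    ≤-trans count (*-monoˡ-≤ _ (begin
      ∑ (seqs (allFin m) n) (ind ∘ f)             ≤⟨ ∑-mono (seqs (allFin m) n) avoid ⟩
      ∑ (seqs (allFin m) n) (vprod nonIdentity)   ≡⟨ ∑-seqs-vprod (allFin m) n nonIdentity ⟩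
      others ^ n                                       ∎))
    where
    open ≤-Reasoning
    avoid : ∀ v → ind (f v) ≤ vprod nonIdentity v
    avoid v with f v in fv
    ... | false = z≤n
    ... | true  = ≤-reflexive (sym (vprod-ones nonIdentity v λ t → one t))
      where
      one : ∀ t → nonIdentity (lookup v t) ≡ 1
      one t with lookup v t ≟ᶠ i₀
      ... | yes e = contradiction (trivial-of-identity a V S v t e (carried v (subst T (sym fv) tt))) nontrivial
      ... | no _  = refl

  exponential-bound : ExpParallelRepetition Q
  exponential-bound with K in K-eq
  ... | zero   = contradiction K>0 (subst (λ x → ¬ 0 < x) (sym K-eq) (λ ()))
  ... | suc K′ = c , suc c , ≤-refl , bound
    where
    open ≤-Reasoning
    c : ℕ
    -- The base is 1 - 1/(mK), chosen so that by `root-bound` its `K`-th power is at least `others`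
    -- divided by `m`. It depends only on the sampling, not on the game or on `n`.
    c = pred (m * suc K′)
    c-eq : suc c ≡ m * suc K′
    c-eq = suc-pred (m * suc K′) {{m*n≢0 m (suc K′) {{m-nonZero}}}}
    q = length (questions Q)
    bound : ∀ n a (V : Verifier Q a) → ¬ Trivial Q a V → (S : RepStrategy Q a n) →
            repWins Q a V n S * suc c ^ n ≤ c ^ n * q ^ n
    -- Since `hits-bound` controls the `K`-th power of the winning count, the claim is compared
    -- after raising to that power and multiplying by `m ^ n`.
    bound n a V nt S = ^-cancelˡ-≤ (suc K′) (s≤s z≤n) (*-cancelˡ-≤ (m ^ n) {{m^n≢0 m n {{m-nonZero}}}} (begin
      m ^ n * (w * suc c ^ n) ^ κ
        ≡⟨ cong (m ^ n *_) (trans (^-distribʳ-* κ w _) (cong (w ^ κ *_) (^-swap (suc c)))) ⟩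
      m ^ n * (w ^ κ * (suc c ^ κ) ^ n)
        ≡⟨ regroup (m ^ n) (w ^ κ) _ ⟩
      w ^ κ * m ^ n * (suc c ^ κ) ^ n
        ≤⟨ *-monoˡ-≤ _ (subst (λ K → w ^ K * m ^ n ≤ others ^ n * q ^ (n * K)) K-eq (hits-bound n a V nt S)) ⟩
      others ^ n * q ^ (n * κ) * (suc c ^ κ) ^ n
        ≡⟨ regroup₂ (others ^ n) _ _ ⟩
      others ^ n * (suc c ^ κ) ^ n * q ^ (n * κ)
        ≡⟨ cong (_* q ^ (n * κ)) (^-distribʳ-* n others (suc c ^ κ)) ⟨
      (others * suc c ^ κ) ^ n * q ^ (n * κ)
        ≤⟨ *-monoˡ-≤ _ (^-monoˡ-≤ n (root-bound K′ others<m c-eq)) ⟩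
      (m * c ^ κ) ^ n * q ^ (n * κ)
        ≡⟨ cong₂ _*_ (^-distribʳ-* n m (c ^ κ)) (sym (^-*-assoc q n κ)) ⟩
      m ^ n * (c ^ κ) ^ n * (q ^ n) ^ κ
        ≡⟨ *-assoc (m ^ n) _ _ ⟩
      m ^ n * ((c ^ κ) ^ n * (q ^ n) ^ κ)
        ≡⟨ cong (m ^ n *_) (trans (^-distribʳ-* κ (c ^ n) (q ^ n)) (cong (_* (q ^ n) ^ κ) (^-swap c))) ⟨
      m ^ n * (c ^ n * q ^ n) ^ κ ∎))
      where
      κ = suc K′
      w = repWins Q a V n S
      ^-swap : ∀ x → (x ^ n) ^ κ ≡ (x ^ κ) ^ n
      ^-swap x = trans (^-*-assoc x n κ) (trans (cong (x ^_) (*-comm n κ)) (sym (^-*-assoc x κ n)))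
      regroup : ∀ a b c → a * (b * c) ≡ b * a * c
      regroup = solve-∀
      regroup₂ : ∀ a b c → a * b * c ≡ a * c * b
      regroup₂ = solve-∀

theorem1p10 : ∀ {r} (Q : QuestionSet r) → Constructible (asHyp Q) → ExpParallelRepetition Q
theorem1p10 Q c = exponential-bound Q (sampling Q c)
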